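{- Let $f$ be a tamely ramified rational function of degree $d\ge2$ defined over a field $K$ such that $G=G_\infty(K^{\mathrm{sep}},f,t)$ is a martingale group; if $f$ is exceptional, assume furthermore that $K$ has characteristic zero and cardinality at most $2^{\aleph_0}$. Let $N$ be a delay constant for which $G_m$ (defined in the context) is a mixing subgroup of $G$, and let $G_M$ be the maximal mixing subgroup of $G$ with delay constant $N$. If $G_m$ is project invariant, then $G_m=G_M$.
   Context: Trees. $T$ is the rooted tree whose vertices are the finite words over $\{1,\dots,d\}$ (root: empty word; $v$ adjacent to $vx$). $|v|$ is word length and $\mathcal L_n$ the set of words of length $n$. $\mathrm{Aut}(T)$ is the group of rooted tree automorphisms with the congruence topology (pointwise stabilizers of levels form a basis of neighbourhoods of $1$). The section $g|_v$ is defined by $g(vw)=g(v)\,g|_v(w)$. For $G\le \mathrm{Aut}(T)$: $\mathrm{st}_G(v)$ is the stabilizer of $v$, $\mathrm{St}_G(n)=\bigcap_{v\in\mathcal L_n}\mathrm{st}_G(v)$, and for $H\le G$, $H_v=\{h|_v: h\in H,\ h(v)=v\}$. $G$ is self-similar if $g|_v\in G$ for all $g\in G$, $v\in T$; fractal if it is self-similar, transitive on every level, and $G_v=G$ for all $v$. $G$ is a martingale group if for all $n\ge1$ and $v\in\mathcal L_n$, $\mathrm{St}_G(n)$ acts transitively on each level of the subtree $T_v=\{vw\}$. A fractal $G$ is virtually mixing if there are $N\ge0$ (a delay constant) and a finite-index subgroup $H\le G$ (a mixing subgroup) with $H\le \mathrm{St}_G(n)_v$ for all $n\ge1$ and all $v$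 with $|v|\ge n+N$. The maximal mixing subgroup with delay constant $N$ is $G_M=\bigcap_{n\ge1}\bigcap_{v\in\mathcal L_{n+N}}\mathrm{St}_G(n)_v$. A subgroup $H$ of a self-similar group $G$ is project invariant if $H_v\le H$ for all $v\in T$. Galois groups. $\overline K$, $K^{\mathrm{sep}}$ are algebraic and separable closures, $t$ is transcendental over $K$. $e_f(z)$ is the local degree of $f$ at $z\in\mathbb P^1(\overline K)$; $f$ is tamely ramified if $\mathrm{char}\,K$ divides no local degree. $f^n$ is the $n$-th iterate. $T_t=\bigsqcup_{n\ge0}f^{ -n}(t)$ is a $d$-regular rooted tree ($w$ in level $n+1$ joined to $f(w)$). $G_\infty(K^{\mathrm{sep}},f,t)$ is the image of $\mathrm{Gal}(K^{\mathrm{sep}}(t)^{\mathrm{sep}}/K^{\mathrm{sep}}(t))$ in $\mathrm{Aut}(T_t)$; it is closed. It is known that some isomorphism of rooted trees $T_t\to T$ makes this group a fractal subgroup of $\mathrm{Aut}(T)$; such an identification is fixed. Orbifolds. $C_f=\{z:e_f(z)>1\}$, $P_f=\bigcup_{n\ge1}f^n(C_f)$; $f$ is post-critically finite if $P_f$ is finite. $\nu_f(z)=\mathrm{lcm}\{e_{f^n}(w): n\ge1, f^n(w)=z\}\in\mathbb N\cup\{\infty\}$. For $f$ post-critically finite, $\chi_f=2-\sum_{z\in P_f}(1-1/\nu_f(z))$; $f$ is exceptional if it is post-critically finite and $\chi_f=0$. Energy. A (backward) path is $\gamma:\{0,\dots,L\}\to\mathbb P^1(\overline K)$ with $f(\gamma(i+1))=\gamma(i)$;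 $\ell(\gamma)=L$, $E(\gamma)=\prod_{i=1}^{L}e_f(\gamma(i))$. For $p\in P_f$, a good pair of $p$ is a pair $(\gamma_1,\gamma_2)$ of paths with $\gamma_1(0)=\gamma_2(0)$, $\gamma_1$ ending at $p$, $\gamma_2$ ending outside $P_f$, and $\ell(\gamma_1)\ge\ell(\gamma_2)$. $\Gamma_{f,p}$ is the set of good pairs of $p$; $\mathcal E(\gamma_1,\gamma_2)=E(\gamma_2)/\gcd(E(\gamma_1),E(\gamma_2))$. $e_p=\gcd\{\mathcal E(P):P\in\Gamma_{f,p}\}$ if $\Gamma_{f,p}\ne\emptyset$ and $e_p=1$ otherwise. Inertia generators. $G_\infty(K^{\mathrm{sep}},f,t)$ is topologically generated by elements $g_p$ ($p\in P_f$), each a topological generator of an inertia subgroup at a prime of the integral closure above $(t-p)$ (the place $t=\infty$ if $p=\infty$), chosen so that for a suitable ordering $\prod_{p\in P_f}g_p=1$. The subgroup $G_m$. Unless $f$ is exceptional with $\nu_f(z)<\infty$ for all $z$, $G_m$ is the normal closure in $G$ of the closed subgroup topologically generated by $\{g_p^{e_p}:p\in P_f\}$. If $f$ is exceptional with $\nu_f(z)<\infty$ for all $z$ (and $K$ is as in the claim), embed $\overline K\subset\mathbb C$; there are a lattice $\Lambda\subset\mathbb C$, a map $F(z)=az+b$ of $\mathbb C/\Lambda$ with $a\Lambda\subseteq\Lambda$, and a finite cyclic group $H=\langle z\mapsto\epsilon z\rangle\le\mathrm{Aut}(\mathbb C/\Lambda)$ with quotient map $\pi:\mathbb C/\Lambda\to\mathbb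 P^1(\mathbb C)$ and $\pi F=f\pi$; then $G\cong\overline{\mathrm{IMG}(f)}$, $\mathrm{IMG}(F)$ embeds in $\mathrm{IMG}(f)$ via $\pi$, and $G_m=\overline{\mathrm{IMG}(F)}$. Here for a finite degree-$d$ (branched) cover $h:X\to X$ with post-critical set $P_h$ and base point $x_0\notin P_h$, $\mathrm{IMG}(h)$ is the image of the monodromy action of $\pi_1(X\setminus P_h,x_0)$ on the tree $\bigsqcup_n h^{ -n}(x_0)$, and closures are taken in the automorphism group of the tree. In all cases $G_m$ is a closed normal mixing subgroup of $G$ for some delay constant. -}

module Defs where

open import Level using (Level; Lift; 0ℓ; suc; _⊔_)
open import Algebra.Apartness.Bundles using (HeytingCommutativeRing; HeytingField)
open import Algebra.Bundles using (CommutativeRing; Group)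
open import Algebra.Bundles.Raw using (RawRing; RawSemiring)
open import Algebra.Morphism.Structures using (IsRingHomomorphism; IsRingIsomorphism)
import Algebra.Definitions.RawMonoid as RawMonoidOps
import Algebra.Definitions.RawSemiring as RawSemiringOps
import Algebra.Properties.Ring as RingProperties
open import Data.Bool.Base using (Bool)
open import Data.Empty using (⊥; ⊥-elim)
open import Data.Fin.Base as Fin using (Fin; toℕ; fromℕ)
open import Data.Integer.Base using (ℤ; +_; -[1+_])
open import Data.List.Base as List using (List; []; _∷_; _++_; _∷ʳ_; length; initLast; _∷ʳ′_)
open import Data.List.Properties
  using (++-identityʳ; ++-assoc; ++-cancelˡ; ∷ʳ-injectiveˡ; ∷ʳ-++)
open import Data.List.Relation.Binary.Pointwise using (Pointwise)
open import Data.List.Relation.Unary.AllPairs using (AllPairs)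
open import Data.List.Relation.Unary.Any using (Any)
open import Data.Nat.Base as ℕ using (ℕ; _≥_; _>_; _∸_; NonZero)
open import Data.Nat.Divisibility using (_∣_; quotient)
open import Data.Nat.GCD using (gcd; gcd[m,n]∣n)
open import Data.Product.Base using (Σ-syntax; ∃; ∃-syntax; _×_; _,_; proj₁; proj₂)
open import Data.Rational.Base as ℚ using (ℚ; 0ℚ; 1ℚ)
open import Data.Sum.Base using (_⊎_; inj₁; inj₂)
open import Data.Vec.Functional as Vector using ()
open import Function.Base using (id; _∘_)
open import Function.Bundles using (_⇔_)
open import Relation.Binary.Core using (Rel)
open import Relation.Binary.PropositionalEquality
  using (_≡_; refl; sym; trans; cong; module ≡-Reasoning)
open import Relation.Binary.Structures using (IsStrictTotalOrder; IsTotalOrder)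
open import Relation.Nullary.Negation using (¬_)
open import Relation.Unary using (Pred; _∈_; _∉_; _⊆_; _≐_)

Word : ℕ → Set
Word d = List (Fin d)

-- The inverse preserves the root and adjacency automatically, see `_⁻¹`.
record TreeAut (d : ℕ) : Set where
  field
    to      : Word d → Word d
    from    : Word d → Word d
    to-from : ∀ w → to (from w) ≡ w
    from-to : ∀ w → from (to w) ≡ w
    root    : to [] ≡ []
    child   : ∀ v x → ∃[ y ] to (v ∷ʳ x) ≡ to v ∷ʳ y

open TreeAut public

infix 4 _≋_

_≋_ : ∀ {d} → Rel (TreeAut d) 0ℓ
g ≋ h = ∀ w → to g w ≡ to h w

idᵗ : ∀ {d} → TreeAut d
idᵗ = record
  { to = id ; from = id ; to-from = λ _ → refl ; from-to = λ _ → refl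
  ; root = refl ; child = λ v x → x , refl }

infixl 7 _∙_
infix  8 _⁻¹

_∙_ : ∀ {d} → TreeAut d → TreeAut d → TreeAut d
g ∙ h = record
  { to      = to g ∘ to h
  ; from    = from h ∘ from g
  ; to-from = λ w → trans (cong (to g) (to-from h (from g w))) (to-from g w)
  ; from-to = λ w → trans (cong (from h) (from-to g (to h w))) (from-to h w)
  ; root    = trans (cong (to g) (root h)) (root g)
  ; child   = λ v x → let (y , p) = child h v x ; (z , q) = child g (to h v) y
                      in z , trans (cong (to g) p) q
  }

_⁻¹ : ∀ {d} → TreeAut d → TreeAut d
_⁻¹ {d} g = record
  { to      = from g
  ; from    = to g
  ; to-from = from-to g
  ; from-to = to-from g
  ; root    = trans (cong (from g) (sym (root g))) (from-to g [])
  ; child   = λ w y → lemma w y (from g (w ∷ʳ y)) (to-from g (w ∷ʳ y))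
  }
  where
  []≢∷ʳ : ∀ (w : Word d) y → ¬ [] ≡ w ∷ʳ y
  []≢∷ʳ []      y ()
  []≢∷ʳ (_ ∷ _) y ()

  lemma : ∀ w y u → to g u ≡ w ∷ʳ y → ∃[ x ] u ≡ from g w ∷ʳ x
  lemma w y u e with initLast u
  ... | []       = ⊥-elim ([]≢∷ʳ w y (trans (sym (root g)) e))
  ... | u′ ∷ʳ′ x =
    let (y′ , p) = child g u′ x
        q        = ∷ʳ-injectiveˡ (to g u′) w (trans (sym p) e)
    in x , cong (_∷ʳ x) (trans (sym (from-to g u′)) (cong (from g) q))

Aut : ℕ → Group 0ℓ 0ℓ
Aut d = record
  { Carrier = TreeAut d ; _≈_ = _≋_ ; _∙_ = _∙_ ; ε = idᵗ ; _⁻¹ = _⁻¹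
  ; isGroup = record
    { isMonoid = record
      { isSemigroup = record
        { isMagma = record
          { isEquivalence = record
            { refl  = λ _ → refl
            ; sym   = λ p w → sym (p w)
            ; trans = λ p q w → trans (p w) (q w) }
          ; ∙-cong = λ {g} {g′} {h} {h′} p q w →
              trans (cong (to g) (q w)) (p (to h′ w)) }
        ; assoc = λ _ _ _ _ → refl }
      ; identity = (λ _ _ → refl) , (λ _ _ → refl) }
    ; inverse = from-to , to-from
    ; ⁻¹-cong = λ {g} {h} p w →
        trans (cong (from g) (sym (to-from h w)))
              (trans (cong (from g) (sym (p (from h w)))) (from-to g (from h w)))
    } }

infixr 8 _^ᵃ_

_^ᵃ_ : ∀ {d} → TreeAut d → ℕ → TreeAut d
_^ᵃ_ {d} g n = n RM.× g
  where module RM = RawMonoidOps (Group.rawMonoid (Aut d))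

productᵃ : ∀ {d} → List (TreeAut d) → TreeAut d
productᵃ = List.foldr _∙_ idᵗ

to-++ : ∀ {d} (g : TreeAut d) v w → ∃[ k ] to g (v ++ w) ≡ to g v ++ k
to-++ g v []      = [] , trans (cong (to g) (++-identityʳ v)) (sym (++-identityʳ (to g v)))
to-++ g v (x ∷ w) =
  let (y , p) = child g v x
      (k , q) = to-++ g (v ∷ʳ x) w
  in y ∷ k , (begin
    to g (v ++ x ∷ w)     ≡⟨ cong (to g) (sym (∷ʳ-++ v x w)) ⟩
    to g ((v ∷ʳ x) ++ w)  ≡⟨ q ⟩
    to g (v ∷ʳ x) ++ k    ≡⟨ cong (_++ k) p ⟩
    (to g v ∷ʳ y) ++ k    ≡⟨ ∷ʳ-++ (to g v) y k ⟩
    to g v ++ y ∷ k       ∎)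
  where open ≡-Reasoning

section : ∀ {d} → TreeAut d → Word d → TreeAut d
section {d} g v = record
  { to      = s
  ; from    = s⁻
  ; to-from = λ w → ++-cancelˡ (to g v) _ _ (begin
      to g v ++ s (s⁻ w)        ≡⟨ s-spec (s⁻ w) ⟨
      to g (v ++ s⁻ w)          ≡⟨ cong (to g) (s⁻-spec w) ⟨
      to g (from g (to g v ++ w)) ≡⟨ to-from g _ ⟩
      to g v ++ w               ∎)
  ; from-to = λ w → ++-cancelˡ v _ _ (begin
      v ++ s⁻ (s w)             ≡⟨ s⁻-spec (s w) ⟨
      from g (to g v ++ s w)    ≡⟨ cong (from g) (s-spec w) ⟨
      from g (to g (v ++ w))    ≡⟨ from-to g _ ⟩
      v ++ w                    ∎)
  ; root    = ++-cancelˡ (to g v) _ _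
      (trans (sym (s-spec []))
             (trans (cong (to g) (++-identityʳ v)) (sym (++-identityʳ (to g v)))))
  ; child   = λ w x → let (y , p) = child g (v ++ w) x in
      y , ++-cancelˡ (to g v) _ _ (begin
        to g v ++ s (w ∷ʳ x)      ≡⟨ s-spec (w ∷ʳ x) ⟨
        to g (v ++ (w ∷ʳ x))      ≡⟨ cong (to g) (sym (++-assoc v w (x ∷ []))) ⟩
        to g ((v ++ w) ∷ʳ x)      ≡⟨ p ⟩
        to g (v ++ w) ∷ʳ y        ≡⟨ cong (_∷ʳ y) (s-spec w) ⟩
        (to g v ++ s w) ∷ʳ y      ≡⟨ ++-assoc (to g v) (s w) (y ∷ []) ⟩
        to g v ++ (s w ∷ʳ y)      ∎)
  }
  where
  open ≡-Reasoning
  s : Word d → Word d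
  s w = proj₁ (to-++ g v w)
  s-spec : ∀ w → to g (v ++ w) ≡ to g v ++ s w
  s-spec w = proj₂ (to-++ g v w)
  s⁻ : Word d → Word d
  s⁻ w = proj₁ (to-++ (g ⁻¹) (to g v) w)
  s⁻-spec : ∀ w → from g (to g v ++ w) ≡ v ++ s⁻ w
  s⁻-spec w = trans (proj₂ (to-++ (g ⁻¹) (to g v) w)) (cong (_++ s⁻ w) (from-to g v))

module _ {d : ℕ} {ℓ : Level} where

  record IsSubgroup (H : Pred (TreeAut d) ℓ) : Set ℓ where
    field
      resp      : ∀ {g h} → g ≋ h → g ∈ H → h ∈ H
      ε-closed  : idᵗ ∈ H
      ∙-closed  : ∀ {g h} → g ∈ H → h ∈ H → g ∙ h ∈ H
      ⁻¹-closed : ∀ {g} → g ∈ H → g ⁻¹ ∈ H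

  data ⟨_⟩ (S : Pred (TreeAut d) ℓ) : Pred (TreeAut d) ℓ where
    gen  : ∀ {g} → g ∈ S → g ∈ ⟨ S ⟩
    ext  : ∀ {g h} → g ≋ h → g ∈ ⟨ S ⟩ → h ∈ ⟨ S ⟩
    unit : idᵗ ∈ ⟨ S ⟩
    mul  : ∀ {g h} → g ∈ ⟨ S ⟩ → h ∈ ⟨ S ⟩ → g ∙ h ∈ ⟨ S ⟩
    inv  : ∀ {g} → g ∈ ⟨ S ⟩ → g ⁻¹ ∈ ⟨ S ⟩

  -- Topological closure: g ∈ H·St(n) for all n.
  closure : Pred (TreeAut d) ℓ → Pred (TreeAut d) ℓ
  closure H g = ∀ n → ∃[ h ] (h ∈ H × (∀ w → length w ≡ n → to h w ≡ to g w))

  -- Normal closure in the sense of topological groups: the smallest closed normal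
  -- subgroup of a closed subgroup G that contains S ⊆ G.
  normalClosure : (G S : Pred (TreeAut d) ℓ) → Pred (TreeAut d) ℓ
  normalClosure G S =
    closure ⟨ (λ h → ∃[ g ] ∃[ s ] (g ∈ G × s ∈ S × g ∙ s ∙ g ⁻¹ ≋ h)) ⟩

  st : Pred (TreeAut d) ℓ → Word d → Pred (TreeAut d) ℓ
  st G v g = g ∈ G × to g v ≡ v

  St : Pred (TreeAut d) ℓ → ℕ → Pred (TreeAut d) ℓ
  St G n g = g ∈ G × (∀ v → length v ≡ n → g ∈ st G v)

  infix 9 _at_

  _at_ : Pred (TreeAut d) ℓ → Word d → Pred (TreeAut d) ℓ
  (H at v) k = ∃[ h ] (h ∈ st H v × section h v ≋ k)

  SelfSimilar : Pred (TreeAut d) ℓ → Set ℓ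
  SelfSimilar G = ∀ g v → g ∈ G → section g v ∈ G

  LevelTransitive : Pred (TreeAut d) ℓ → Set ℓ
  LevelTransitive G = ∀ v w → length v ≡ length w → ∃[ g ] (g ∈ G × to g v ≡ w)

  Fractal : Pred (TreeAut d) ℓ → Set ℓ
  Fractal G = SelfSimilar G × LevelTransitive G × (∀ v → G at v ≐ G)

  Martingale : Pred (TreeAut d) ℓ → Set ℓ
  Martingale G = ∀ n v → n ≥ 1 → length v ≡ n →
    ∀ w w′ → length w ≡ length w′ → ∃[ g ] (g ∈ St G n × to g (v ++ w) ≡ v ++ w′)

  FiniteIndexIn : (G H : Pred (TreeAut d) ℓ) → Set ℓ
  FiniteIndexIn G H = ∃[ k ] Σ[ r ∈ (Fin k → TreeAut d) ]
    ((∀ i → r i ∈ G) × (∀ g → g ∈ G → ∃[ i ] ∃[ h ] (h ∈ H × g ≋ r i ∙ h)))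

  record MixingSubgroup (G : Pred (TreeAut d) ℓ) (N : ℕ) (H : Pred (TreeAut d) ℓ) : Set ℓ where
    field
      isSubgroup  : IsSubgroup H
      H⊆G         : H ⊆ G
      finiteIndex : FiniteIndexIn G H
      mixing      : ∀ n v → n ≥ 1 → length v ≥ n ℕ.+ N → H ⊆ St G n at v

  maximalMixing : Pred (TreeAut d) ℓ → ℕ → Pred (TreeAut d) ℓ
  maximalMixing G N g = ∀ n v → n ≥ 1 → length v ≡ n ℕ.+ N → g ∈ St G n at v

  ProjectInvariant : Pred (TreeAut d) ℓ → Set ℓ
  ProjectInvariant H = ∀ v → H at v ⊆ H

module _ {a b : Level} {X : Set a} (_≈_ _↦_ : Rel X b) where

  Iterate : ℕ → X → X → Set (a ⊔ b)
  Iterate ℕ.zero    x y = Lift a (x ≈ y)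
  Iterate (ℕ.suc n) x y = ∃[ z ] (x ↦ z × Iterate n z y)

  -- An isomorphism from the tree of words onto ⨆ₙ h⁻ⁿ(x₀).
  record PreimageTree (d : ℕ) (x₀ : X) : Set (a ⊔ b) where
    field
      label      : Word d → X
      label-root : label [] ≈ x₀
      label-edge : ∀ v i → label (v ∷ʳ i) ↦ label v
      injective  : ∀ v w → length v ≡ length w → label v ≈ label w → v ≡ w
      surjective : ∀ v y → y ↦ label v → ∃[ i ] label (v ∷ʳ i) ≈ y

-- Polynomials are coefficient lists, constant term first.

module Polynomial {c ℓ : Level} (R : RawRing c ℓ) where

  open RawRing R

  Poly : Set c
  Poly = List Carrier

  coeff : Poly → ℕ → Carrier
  coeff []      _         = 0#
  coeff (a ∷ p) ℕ.zero    = a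
  coeff (a ∷ p) (ℕ.suc i) = coeff p i

  _+ᴾ_ : Poly → Poly → Poly
  []      +ᴾ q       = q
  (a ∷ p) +ᴾ []      = a ∷ p
  (a ∷ p) +ᴾ (b ∷ q) = (a + b) ∷ (p +ᴾ q)

  _*ᴾ_ : Poly → Poly → Poly
  []      *ᴾ q = []
  (a ∷ p) *ᴾ q = List.map (a *_) q +ᴾ (0# ∷ (p *ᴾ q))

  polyRing : RawRing c ℓ
  polyRing = record
    { Carrier = Poly
    ; _≈_     = λ p q → ∀ i → coeff p i ≈ coeff q i
    ; _+_     = _+ᴾ_
    ; _*_     = _*ᴾ_
    ; -_      = List.map -_
    ; 0#      = []
    ; 1#      = 1# ∷ []
    }

  eval : Poly → Carrier → Carrier
  eval p x = List.foldr (λ a r → a + x * r) 0# p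

  derivative : Poly → Poly
  derivative []      = []
  derivative (a ∷ p) = go 1 p
    where
    go : ℕ → Poly → Poly
    go n []      = []
    go n (b ∷ q) = RawMonoidOps._×_ +-rawMonoid n b ∷ go (ℕ.suc n) q

  Zero : Poly → Set ℓ
  Zero p = ∀ i → coeff p i ≈ 0#

  NonConstant : Poly → Set ℓ
  NonConstant p = ∃[ i ] (i ≥ 1 × coeff p i ≉ 0#)

  Coprime : Poly → Poly → Set (c ⊔ ℓ)
  Coprime = RawSemiringOps.Coprime (RawRing.rawSemiring polyRing)

  Separable : Poly → Set (c ⊔ ℓ)
  Separable p = Coprime p (derivative p)

-- Σᵢ φ(pᵢ) xⁱ yⁿ⁻ⁱ, the form of degree n with dehomogenisation p.
module _ {c ℓ c′ ℓ′ : Level} (A : RawRing c ℓ) (B : RawRing c′ ℓ′) where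

  private
    module A = RawRing A
    module B = RawRing B
    open RawSemiringOps B.rawSemiring using (_^_; sum)

  homEval : (A.Carrier → B.Carrier) → ℕ → List A.Carrier → B.Carrier → B.Carrier → B.Carrier
  homEval φ n p x y =
    sum {ℕ.suc n} λ i → φ (Polynomial.coeff A p (toℕ i)) B.* ((x ^ toℕ i) B.* (y ^ (n ∸ toℕ i)))

data ℙ¹ {c : Level} (A : Set c) : Set c where
  aff : A → ℙ¹ A
  ∞   : ℙ¹ A

map-ℙ¹ : ∀ {a b} {A : Set a} {B : Set b} → (A → B) → ℙ¹ A → ℙ¹ B
map-ℙ¹ φ (aff x) = aff (φ x)
map-ℙ¹ φ ∞       = ∞

-- The fraction num/den, read as a pair of binary forms of degree deg.
record Fraction {c : Level} (A : Set c) : Set c where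
  field
    deg     : ℕ
    num den : List A

open Fraction public

map-Fraction : ∀ {a b} {A : Set a} {B : Set b} → (A → B) → Fraction A → Fraction B
map-Fraction φ f = record { deg = deg f ; num = List.map φ (num f) ; den = List.map φ (den f) }

module Rational {ℓ : Level} (R : RawRing ℓ ℓ) where

  open RawRing R
  open Polynomial R
  private module P = RawRing polyRing

  Point : Set ℓ
  Point = ℙ¹ Carrier

  X Y : Point → Carrier
  X (aff x) = x
  X ∞       = 1#
  Y (aff x) = 1#
  Y ∞       = 0#

  infix 4 _≈ᴾ_

  _≈ᴾ_ : Rel Point ℓ
  z ≈ᴾ w = X z * Y w ≈ X w * Y z

  record IsRationalFunction (f : Fraction Carrier) : Set ℓ where
    field
      coprime     : Coprime (num f) (den f)
      num-bounded : ∀ i → i > deg f → coeff (num f) i ≈ 0#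
      den-bounded : ∀ i → i > deg f → coeff (den f) i ≈ 0#
      attained    : coeff (num f) (deg f) ≉ 0# ⊎ coeff (den f) (deg f) ≉ 0#

  -- The value of f at z, as a relation.
  infix 4 _⟨_⟩↦_

  _⟨_⟩↦_ : Fraction Carrier → Point → Point → Set ℓ
  f ⟨ z ⟩↦ w = form (num f) * Y w ≈ X w * form (den f)
    where
    form : Poly → Carrier
    form p = homEval R R id (deg f) p (X z) (Y z)

  infixr 9 _⊚_

  _⊚_ : Fraction Carrier → Fraction Carrier → Fraction Carrier
  f ⊚ g = record { deg = deg f ℕ.* deg g ; num = form (num f) ; den = form (den f) }
    where
    form : Poly → Poly
    form p = homEval R polyRing (λ a → a ∷ []) (deg f) p (num g) (den g)

  identity : Fraction Carrier
  identity = record { deg = 1 ; num = 0# ∷ 1# ∷ [] ; den = 1# ∷ [] }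

  iterate : Fraction Carrier → ℕ → Fraction Carrier
  iterate f ℕ.zero    = identity
  iterate f (ℕ.suc n) = f ⊚ iterate f n

  -- r, read as a binary form of degree n, vanishes to order exactly k at the point.
  VanishingOrder : (n : ℕ) → Poly → Point → ℕ → Set ℓ
  VanishingOrder n r (aff x) k =
    ∃[ s ] (r P.≈ ((- x ∷ 1# ∷ []) ^ k) P.* s × eval s x ≉ 0#)
    where open RawSemiringOps P.rawSemiring using (_^_)
  VanishingOrder n r ∞ k =
    ∃[ m ] (m ℕ.+ k ≡ n × coeff r m ≉ 0# × (∀ i → i > m → coeff r i ≈ 0#))

  -- e_f(z) = e, where w = f(z): the order at z of Y(w)·num − X(w)·den.
  LocalDegree : Fraction Carrier → Point → ℕ → Set ℓ
  LocalDegree f z e = ∃[ w ] (f ⟨ z ⟩↦ w ×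
    VanishingOrder (deg f)
      (List.map (Y w *_) (num f) P.+ P.- List.map (X w *_) (den f)) z e)

  module Dynamics (f : Fraction Carrier) where

    Iter : ℕ → Point → Point → Set ℓ
    Iter = Iterate _≈ᴾ_ (f ⟨_⟩↦_)

    Critical : Pred Point ℓ
    Critical z = ∃[ e ] (LocalDegree f z e × e > 1)

    PostCritical : Pred Point ℓ
    PostCritical p = ∃[ n ] ∃[ c ] (n ≥ 1 × c ∈ Critical × Iter n c p)

    data ℕ∞ : Set where
      fin : ℕ → ℕ∞
      ∞   : ℕ∞

    Ramification : Point → Pred ℕ ℓ
    Ramification z e = ∃[ n ] ∃[ w ] (n ≥ 1 × Iter n w z × LocalDegree (iterate f n) w e)

    CommonMultiple : Point → ℕ → Set ℓ
    CommonMultiple z m = ∀ e → e ∈ Ramification z → e ∣ m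

    IsOrbifoldIndex : Point → ℕ∞ → Set ℓ
    IsOrbifoldIndex z (fin m) =
      NonZero m × CommonMultiple z m × (∀ k → CommonMultiple z k → m ∣ k)
    IsOrbifoldIndex z ∞       = ∀ m → NonZero m → ¬ CommonMultiple z m

    FiniteOrbifoldIndices : Set ℓ
    FiniteOrbifoldIndices = ∀ z → ∃[ m ] IsOrbifoldIndex z (fin m)

    reciprocal : ℕ∞ → ℚ
    reciprocal (fin ℕ.zero)    = 0ℚ   -- irrelevant: indices are non-zero
    reciprocal (fin (ℕ.suc n)) = (+ 1) ℚ./ ℕ.suc n
    reciprocal ∞               = 0ℚ

    EnumeratesPostCritical : List Point → Set ℓ
    EnumeratesPostCritical ps =
      AllPairs (λ z w → ¬ z ≈ᴾ w) ps × (∀ z → PostCritical z ⇔ Any (z ≈ᴾ_) ps)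

    IsEulerCharacteristic : List Point → ℚ → Set ℓ
    IsEulerCharacteristic ps χ = Σ[ νs ∈ List ℕ∞ ] (Pointwise IsOrbifoldIndex ps νs ×
      χ ≡ (1ℚ ℚ.+ 1ℚ) ℚ.- List.foldr ℚ._+_ 0ℚ (List.map (λ ν → 1ℚ ℚ.- reciprocal ν) νs))

    Exceptional : Set ℓ
    Exceptional = ∃[ ps ] (EnumeratesPostCritical ps × IsEulerCharacteristic ps 0ℚ)

    record BackwardPath : Set ℓ where
      field
        len  : ℕ
        at   : Fin (ℕ.suc len) → Point
        step : ∀ i → f ⟨ at (Fin.suc i) ⟩↦ at (Fin.inject₁ i)

      start end : Point
      start = at Fin.zero
      end   = at (fromℕ len)

      IsEnergy : ℕ → Set ℓ
      IsEnergy E = Σ[ e ∈ (Fin len → ℕ) ]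
        ((∀ i → LocalDegree f (at (Fin.suc i)) (e i)) × E ≡ Vector.foldr ℕ._*_ 1 e)

    open BackwardPath public

    record GoodPair (p : Point) : Set ℓ where
      field
        γ₁ γ₂   : BackwardPath
        start≈  : start γ₁ ≈ᴾ start γ₂
        end₁    : end γ₁ ≈ᴾ p
        end₂    : end γ₂ ∉ PostCritical
        longer  : len γ₁ ≥ len γ₂

      IsRelativeEnergy : ℕ → Set ℓ
      IsRelativeEnergy q = ∃[ E₁ ] ∃[ E₂ ]
        (IsEnergy γ₁ E₁ × IsEnergy γ₂ E₂ × q ≡ quotient (gcd[m,n]∣n E₁ E₂))

    open GoodPair public

    CommonEnergyDivisor : Point → ℕ → Set ℓ
    CommonEnergyDivisor p m = ∀ (P : GoodPair p) q → IsRelativeEnergy P q → m ∣ q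

    IsEnergyExponent : Point → ℕ → Set ℓ
    IsEnergyExponent p e =
      (GoodPair p → CommonEnergyDivisor p e × (∀ m → CommonEnergyDivisor p m → m ∣ e)) ×
      (¬ GoodPair p → e ≡ 1)

-- Classically the apartness relation is ≉, so that these are exactly the fields.
Field : (ℓ : Level) → Set (suc ℓ)
Field ℓ = HeytingField ℓ ℓ ℓ

∣_∣ : ∀ {ℓ} → Field ℓ → Set ℓ
∣ F ∣ = HeytingField.Carrier F

raw : ∀ {ℓ} → Field ℓ → RawRing ℓ ℓ
raw F = record
  { Carrier = Carrier ; _≈_ = _≈_ ; _+_ = _+_ ; _*_ = _*_ ; -_ = -_ ; 0# = 0# ; 1# = 1# }
  where open HeytingField F

HasCharacteristic : ∀ {ℓ} → Field ℓ → ℕ → Set ℓ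
HasCharacteristic F p = ∀ n → ((n • 1#) ≈ 0#) ⇔ (p ∣ n)
  where
  open RawRing (raw F)
  open RawMonoidOps +-rawMonoid using () renaming (_×_ to _•_)

CardinalityAtMostContinuum : ∀ {ℓ} → Field ℓ → Set ℓ
CardinalityAtMostContinuum F = Σ[ j ∈ (∣ F ∣ → ℕ → Bool) ]
  (∀ x y → (x ≈ y) ⇔ (∀ n → j x n ≡ j y n))
  where open HeytingField F

record Extension {ℓ : Level} (F E : Field ℓ) : Set ℓ where
  field
    embed : ∣ F ∣ → ∣ E ∣
    isHom : IsRingHomomorphism (raw F) (raw E) embed

open Extension public

module _ {ℓ : Level} {F E : Field ℓ} (ι : Extension F E) where

  private
    module PF = Polynomial (raw F)
    module PE = Polynomial (raw E)
    module E = HeytingField E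

  record IsAlgebraicClosure : Set ℓ where
    field
      algebraic : ∀ x → ∃[ p ] (¬ PF.Zero p × PE.eval (List.map (embed ι) p) x E.≈ E.0#)
      closed    : ∀ p → PE.NonConstant p → ∃[ x ] PE.eval p x E.≈ E.0#

  record IsSeparableClosure : Set ℓ where
    field
      separable : ∀ x → ∃[ p ] (¬ PF.Zero p × PF.Separable p ×
                                PE.eval (List.map (embed ι) p) x E.≈ E.0#)
      closed    : ∀ p → PE.NonConstant p → PE.Separable p → ∃[ x ] PE.eval p x E.≈ E.0#

  -- E = F(t) with t transcendental over F.
  record IsRationalFunctionField (t : ∣ E ∣) : Set ℓ where
    field
      transcendental : ∀ p → PE.eval (List.map (embed ι) p) t E.≈ E.0# → PF.Zero p
      generated      : ∀ y → ∃[ p ] ∃[ q ]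
        (¬ PE.eval (List.map (embed ι) q) t E.≈ E.0# ×
         y E.* PE.eval (List.map (embed ι) q) t E.≈ PE.eval (List.map (embed ι) p) t)

-- K̄ ⊇ Kˢ ⊇ K,  L = Kˢ(t)  and  M = Lˢ.
record Tower (ℓ : Level) : Set (suc ℓ) where
  field
    K K̄ Kˢ L M : Field ℓ
    K→K̄  : Extension K K̄
    K→Kˢ : Extension K Kˢ
    Kˢ→K̄ : Extension Kˢ K̄
    Kˢ→L : Extension Kˢ L
    L→M  : Extension L M
    t    : ∣ L ∣
    commutes : ∀ x → HeytingField._≈_ K̄ (embed Kˢ→K̄ (embed K→Kˢ x)) (embed K→K̄ x)
    K̄-isAlgebraicClosure     : IsAlgebraicClosure K→K̄
    Kˢ-isSeparableClosure    : IsSeparableClosure K→Kˢ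
    L-isRationalFunctionField : IsRationalFunctionField Kˢ→L t
    M-isSeparableClosure     : IsSeparableClosure L→M

-- Classically, such a structure is unique up to isomorphism.
record CompleteOrderedField (ℓ : Level) : Set (suc ℓ) where
  field
    R : Field ℓ
  open HeytingField R
    using (Carrier; _≈_; _+_; _*_; -_; 0#; 1#)
  infix 4 _≤ᴿ_ _<ᴿ_
  field
    _≤ᴿ_          : Rel Carrier ℓ
    isTotalOrder : IsTotalOrder _≈_ _≤ᴿ_
    +-mono       : ∀ {x y} z → x ≤ᴿ y → x + z ≤ᴿ y + z
    *-nonneg     : ∀ {x y} → 0# ≤ᴿ x → 0# ≤ᴿ y → 0# ≤ᴿ x * y
  UpperBound : Pred Carrier ℓ → Pred Carrier ℓ
  UpperBound A u = ∀ x → x ∈ A → x ≤ᴿ u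
  field
    complete : ∀ (A : Pred Carrier ℓ) → ∃ A → ∃ (UpperBound A) →
      ∃[ s ] (s ∈ UpperBound A × (∀ u → u ∈ UpperBound A → s ≤ᴿ u))

  _<ᴿ_ : Rel Carrier ℓ
  x <ᴿ y = x ≤ᴿ y × ¬ x ≈ y

module Complex {ℓ : Level} (ℝ : CompleteOrderedField ℓ) where

  open CompleteOrderedField ℝ
  open HeytingField R using (Carrier; _≈_; _+_; _*_; -_; _-_; 0#; 1#)

  ℂ : RawRing ℓ ℓ
  ℂ = record
    { Carrier = Carrier × Carrier
    ; _≈_ = λ (x , y) (u , v) → x ≈ u × y ≈ v
    ; _+_ = λ (x , y) (u , v) → x + u , y + v
    ; _*_ = λ (x , y) (u , v) → x * u - y * v , x * v + y * u
    ; -_  = λ (x , y) → - x , - y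
    ; 0#  = 0# , 0#
    ; 1#  = 1# , 0#
    }

  module C = RawRing ℂ

  scale : Carrier → C.Carrier → C.Carrier
  scale r (x , y) = r * x , r * y

  normSq : C.Carrier → Carrier
  normSq (x , y) = x * x + y * y

  _−_ : C.Carrier → C.Carrier → C.Carrier
  z − w = z C.+ C.- w

  open Rational ℂ using (Point; X; Y; _≈ᴾ_)

  -- Distances are compared through their squares.  On ℙ¹(ℂ) the distance is
  -- the chordal one, ∣X(z)Y(w) − X(w)Y(z)∣² / (∥z∥² ∥w∥²) < δ.

  nearℙ¹ : Carrier → Rel Point ℓ
  nearℙ¹ δ z w = normSq ((X z C.* Y w) − (X w C.* Y z)) <ᴿ
    δ * ((normSq (X z) + normSq (Y z)) * (normSq (X w) + normSq (Y w)))

  UnitInterval : Set ℓ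
  UnitInterval = Σ[ s ∈ Carrier ] (0# ≤ᴿ s × s ≤ᴿ 1#)

  0≤1 : 0# ≤ᴿ 1#
  0≤1 with IsTotalOrder.total isTotalOrder 0# 1#
  ... | inj₁ p   = p
  ... | inj₂ 1≤0 = ≤.trans (*-nonneg 0≤-1 0≤-1) (≤.reflexive -1*-1≈1)
    where
    module ≤ = IsTotalOrder isTotalOrder
    open CommutativeRing (HeytingCommutativeRing.commutativeRing
                           (HeytingField.heytingCommutativeRing R)) hiding (0#; 1#; _+_; _*_; -_; _≈_)
      renaming (sym to ≈-sym; trans to ≈-trans)
    open RingProperties ring using (-‿distribˡ-*; -‿involutive)
    -1*-1≈1 : (- 1#) * (- 1#) ≈ 1#
    -1*-1≈1 = ≈-trans (≈-sym (-‿distribˡ-* 1# (- 1#)))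
              (≈-trans (-‿cong (*-identityˡ (- 1#))) (-‿involutive 1#))
    0≤-1 : 0# ≤ᴿ - 1#
    0≤-1 = ≤.trans (≤.reflexive (≈-sym (-‿inverseʳ 1#)))
           (≤.trans (+-mono (- 1#) 1≤0) (≤.reflexive (+-identityˡ (- 1#))))

  0ᴵ 1ᴵ : UnitInterval
  0ᴵ = 0# , IsTotalOrder.reflexive isTotalOrder (HeytingField.refl R) , 0≤1
  1ᴵ = 1# , 0≤1 , IsTotalOrder.reflexive isTotalOrder (HeytingField.refl R)

  -- Iterated monodromy group of a map h on a space X with post-critical set P.
  -- The topology of X is given by the relations near δ, for δ > 0.
  module Monodromy {X : Set ℓ} (_≈ˣ_ : Rel X ℓ) (near : Carrier → Rel X ℓ)
                   (_↦_ : Rel X ℓ) (P : Pred X ℓ) where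

    record Path : Set ℓ where
      field
        at         : UnitInterval → X
        continuous : ∀ s ε → 0# <ᴿ ε → ∃[ δ ] (0# <ᴿ δ × (∀ s′ →
          (proj₁ s′ - proj₁ s) * (proj₁ s′ - proj₁ s) <ᴿ δ → near ε (at s) (at s′)))

    open Path public

    IMG : ∀ {d x₀} → PreimageTree _≈ˣ_ _↦_ d x₀ → Pred (TreeAut d) ℓ
    IMG {x₀ = x₀} tree g = Σ[ γ ∈ Path ]
      ( at γ 0ᴵ ≈ˣ x₀ × at γ 1ᴵ ≈ˣ x₀ × (∀ s → at γ s ∉ P)
      × (∀ v → Σ[ γ̃ ∈ Path ]
          ( (∀ s → Iterate _≈ˣ_ _↦_ (length v) (at γ̃ s) (at γ s))
          × at γ̃ 0ᴵ ≈ˣ label v × at γ̃ 1ᴵ ≈ˣ label (to g v))))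
      where open PreimageTree tree

  record IsDifferentiableAt (u : C.Carrier → C.Carrier) (z : C.Carrier) : Set ℓ where
    field
      slope : C.Carrier
      limit : ∀ ε → 0# <ᴿ ε → ∃[ δ ] (0# <ᴿ δ × (∀ h → normSq h <ᴿ δ →
        normSq ((u (z C.+ h) − u z) − (slope C.* h)) ≤ᴿ ε * normSq h))

  -- Locally π = [u : v] with u, v holomorphic without common zeros.
  Holomorphic : (C.Carrier → Point) → Set ℓ
  Holomorphic π = ∀ z₀ → ∃[ u ] ∃[ v ] ∃[ r ] (0# <ᴿ r × (∀ z → normSq (z − z₀) <ᴿ r →
    IsDifferentiableAt u z × IsDifferentiableAt v z ×
    ¬ (u z C.≈ C.0# × v z C.≈ C.0#) × X (π z) C.* v z C.≈ u z C.* Y (π z)))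

  record Lattice : Set ℓ where
    field
      ω₁ ω₂       : C.Carrier
      independent : ∀ r s → (scale r ω₁ C.+ scale s ω₂) C.≈ C.0# → r ≈ 0# × s ≈ 0#

    _·_ : ℤ → C.Carrier → C.Carrier
    (+ n)    · z = RawMonoidOps._×_ C.+-rawMonoid n z
    -[1+ n ] · z = C.- RawMonoidOps._×_ C.+-rawMonoid (ℕ.suc n) z

    Λ : Pred C.Carrier ℓ
    Λ z = ∃[ m ] ∃[ n ] (z C.≈ ((m · ω₁) C.+ (n · ω₂)))

    infix 4 _≈Λ_

    _≈Λ_ : Rel C.Carrier ℓ
    z ≈Λ w = Λ (z − w)

    nearΛ : Carrier → Rel C.Carrier ℓ
    nearΛ δ z w = ∃[ λ′ ] (λ′ ∈ Λ × normSq ((z − w) − λ′) <ᴿ δ)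

module Arboreal {ℓ : Level} (𝕋 : Tower ℓ) (f : Fraction ∣ Tower.K 𝕋 ∣) where

  open Tower 𝕋

  d : ℕ
  d = deg f

  f-K̄ : Fraction ∣ K̄ ∣
  f-K̄ = map-Fraction (embed K→K̄) f

  f-M : Fraction ∣ M ∣
  f-M = map-Fraction (embed L→M ∘ embed Kˢ→L ∘ embed K→Kˢ) f

  private
    module K̄ where
      open HeytingField K̄ public
      open Polynomial (raw K̄) public
    module L = HeytingField L
    module M where
      open HeytingField M public
      open Polynomial (raw M) public
    module PKˢ = Polynomial (raw Kˢ)

  open Rational (raw K̄) using (Point; _≈ᴾ_; LocalDegree)
  open Rational.Dynamics (raw K̄) f-K̄ public
    using (PostCritical; Exceptional; FiniteOrbifoldIndices; IsEnergyExponent)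
  private
    module QM = Rational (raw M)

  TamelyRamified : Set ℓ
  TamelyRamified = ∀ p → HasCharacteristic K p → ∀ z e → LocalDegree f-K̄ z e → ¬ p ∣ e

  -- The choice of an isomorphism T_t ≅ T.
  MarkedTree : Set ℓ
  MarkedTree = PreimageTree QM._≈ᴾ_ (QM._⟨_⟩↦_ f-M) d (aff (embed L→M t))

  record Galois : Set ℓ where
    field
      σ     : ∣ M ∣ → ∣ M ∣
      isIso : IsRingIsomorphism (raw M) (raw M) σ
      fixes : ∀ x → σ (embed L→M x) M.≈ embed L→M x

  -- σ acts on T_t as g does on the tree of words.
  ActsAs : MarkedTree → Galois → TreeAut d → Set ℓ
  ActsAs tree s g = ∀ v → label (to g v) QM.≈ᴾ map-ℙ¹ (Galois.σ s) (label v)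
    where open PreimageTree tree

  G∞ : MarkedTree → Pred (TreeAut d) ℓ
  G∞ tree g = ∃[ s ] ActsAs tree s g

  -- The coordinate u = t (u = 1/t if p = ∞) of ℙ¹ around p, with u(p) = a.
  Coordinate : Point → ∣ L ∣ → ∣ K̄ ∣ → Set ℓ
  Coordinate (aff x) u a = u L.≈ t × a K̄.≈ x
  Coordinate ∞       u a = u L.* t L.≈ L.1# × a K̄.≈ K̄.0#

  module _ (u : ∣ L ∣) where

    evalAt : PKˢ.Poly → ∣ M ∣
    evalAt q = M.eval (List.map (embed L→M ∘ embed Kˢ→L) q) (embed L→M u)

    -- The integral closure of Kˢ[u] in M.
    Integral : Pred ∣ M ∣ ℓ
    Integral x = ∃[ n ] Σ[ q ∈ (Fin n → PKˢ.Poly) ]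
      ((x ^ n) M.+ sum (λ i → evalAt (q i) M.* (x ^ toℕ i))) M.≈ M.0#
      where open RawSemiringOps (RawRing.rawSemiring (raw M)) using (_^_; sum)

    -- A prime 𝔓 of the integral closure with 𝔓 ∩ Kˢ[u] = {q(u) : q(a) = 0}.
    record IsPrimeAbove (a : ∣ K̄ ∣) (𝔓 : Pred ∣ M ∣ ℓ) : Set ℓ where
      field
        ≈-closed  : ∀ {x y} → x M.≈ y → x ∈ 𝔓 → y ∈ 𝔓
        integral  : 𝔓 ⊆ Integral
        +-closed  : ∀ {x y} → x ∈ 𝔓 → y ∈ 𝔓 → x M.+ y ∈ 𝔓
        *-closed  : ∀ {x y} → x ∈ Integral → y ∈ 𝔓 → x M.* y ∈ 𝔓
        proper    : M.1# ∉ 𝔓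
        prime     : ∀ {x y} → x ∈ Integral → y ∈ Integral → x M.* y ∈ 𝔓 → x ∈ 𝔓 ⊎ y ∈ 𝔓
        lies-over : ∀ q → (evalAt q ∈ 𝔓) ⇔ (K̄.eval (List.map (embed Kˢ→K̄) q) a K̄.≈ K̄.0#)

    Inertia : Pred ∣ M ∣ ℓ → Pred Galois ℓ
    Inertia 𝔓 s = ∀ x → x ∈ Integral → Galois.σ s x M.- x ∈ 𝔓

  IsInertiaSubgroup : MarkedTree → Point → Pred (TreeAut d) ℓ → Set (suc ℓ)
  IsInertiaSubgroup tree p I = ∃[ u ] ∃[ a ] ∃[ 𝔓 ] (Coordinate p u a × IsPrimeAbove u a 𝔓 ×
    I ≐ (λ g → ∃[ s ] (s ∈ Inertia u 𝔓 × ActsAs tree s g)))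

  PostCriticalPoint : Set ℓ
  PostCriticalPoint = ∃ PostCritical

  record InertiaGenerators (tree : MarkedTree) : Set (suc ℓ) where
    field
      g      : PostCriticalPoint → TreeAut d
      g-cong : ∀ p q → proj₁ p ≈ᴾ proj₁ q → g p ≋ g q
      inertia  : ∀ p → IsInertiaSubgroup tree (proj₁ p)
                         (closure ⟨ (λ h → Lift ℓ (g p ≋ h)) ⟩)
      generate : G∞ tree ≐ closure ⟨ (λ h → ∃[ p ] g p ≋ h) ⟩
      _≺_      : Rel PostCriticalPoint ℓ
      ≺-isStrictTotalOrder : IsStrictTotalOrder (λ p q → proj₁ p ≈ᴾ proj₁ q) _≺_
      -- ∏ g_p = 1.  P_f may be infinite: on level n the product is the finite
      -- one over the p for which g_p acts non-trivially there.
      product≈1 : ∀ n (ps : List PostCriticalPoint) → AllPairs _≺_ ps →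
        (∀ p → (∀ w → length w ≡ n → to (g p) w ≡ w) ⊎ Any (λ q → proj₁ p ≈ᴾ proj₁ q) ps) →
        ∀ w → length w ≡ n → to (productᵃ (List.map g ps)) w ≡ w

    EnergyPowers : Pred (TreeAut d) ℓ
    EnergyPowers h = ∃[ p ] ∃[ e ] (IsEnergyExponent (proj₁ p) e × g p ^ᵃ e ≋ h)

  -- π : ℂ/Λ → ℙ¹(ℂ), given as a function on ℂ, is the quotient by z ↦ εz
  -- and semiconjugates F(z) = az + b to f.
  record TorusData (tree : MarkedTree) : Set (suc ℓ) where
    field
      ℝ : CompleteOrderedField ℓ
    open Complex ℝ public
    field
      K̄→ℂ      : ∣ K̄ ∣ → C.Carrier
      K̄→ℂ-hom  : IsRingHomomorphism (raw K̄) ℂ K̄→ℂ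
      lattice  : Lattice
    open Lattice lattice public

    f-ℂ : Fraction C.Carrier
    f-ℂ = map-Fraction K̄→ℂ f-K̄

    module Q = Rational ℂ
    open RawSemiringOps C.rawSemiring public using (_^_)

    field
      a b ε    : C.Carrier
      aΛ⊆Λ     : ∀ {z} → z ∈ Λ → a C.* z ∈ Λ
      εΛ⊆Λ     : ∀ {z} → z ∈ Λ → ε C.* z ∈ Λ
      order    : ℕ
      order≥1  : order ≥ 1
      ε^order  : (ε ^ order) C.≈ C.1#

    F : C.Carrier → C.Carrier
    F z = (a C.* z) C.+ b

    field
      π             : C.Carrier → Q.Point
      π-holomorphic : Holomorphic π
      π-surjective  : ∀ p → ∃[ z ] π z Q.≈ᴾ p
      π-fibres      : ∀ z w → (π z Q.≈ᴾ π w) ⇔ (∃[ j ] w ≈Λ (ε ^ j) C.* z)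
      semiconjugate : ∀ z → f-ℂ Q.⟨ π z ⟩↦ π (F z)

    -- F is unramified, so its post-critical set is empty.
    module MonF = Monodromy _≈Λ_ nearΛ (λ z w → F z ≈Λ w) (λ _ → Lift ℓ ⊥)
    module Monf = Monodromy Q._≈ᴾ_ nearℙ¹ (Q._⟨_⟩↦_ f-ℂ) (Q.Dynamics.PostCritical f-ℂ)

    field
      x₀     : Q.Point
      x₀∉P   : x₀ ∉ Q.Dynamics.PostCritical f-ℂ
      y₀     : C.Carrier
      πy₀≈x₀ : π y₀ Q.≈ᴾ x₀
      tree-f : PreimageTree Q._≈ᴾ_ (Q._⟨_⟩↦_ f-ℂ) d x₀
      tree-F : PreimageTree _≈Λ_ (λ z w → F z ≈Λ w) d y₀
      -- The embedding of IMG(F) in IMG(f) is induced by π on the trees.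
      compatible : ∀ v → π (PreimageTree.label tree-F v) Q.≈ᴾ PreimageTree.label tree-f v
      G≐IMG      : G∞ tree ≐ closure (Monf.IMG tree-f)

    IMG-F : Pred (TreeAut d) ℓ
    IMG-F = MonF.IMG tree-F

  -- The choices entering the definition of G_m, in its two cases.
  data Presentation (tree : MarkedTree) : Set (suc ℓ) where
    generic : ¬ (Exceptional × FiniteOrbifoldIndices) → InertiaGenerators tree → Presentation tree
    torus   : Exceptional → FiniteOrbifoldIndices → TorusData tree → Presentation tree

  Gₘ : ∀ {tree} → Presentation tree → Pred (TreeAut d) ℓ
  Gₘ {tree} (generic _ I) = normalClosure (G∞ tree) (closure ⟨ InertiaGenerators.EnergyPowers I ⟩)
  Gₘ        (torus _ _ D) = closure (TorusData.IMG-F D)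

{-# OPTIONS --safe #-}

-- Gₘ is closed of finite index in G, hence open: it contains St G n for some n ≥ 1.
-- An element g of the maximal mixing subgroup is the section at some v, ∣v∣ = n + N,
-- of an element of st G v ∩ St G n ⊆ Gₘ, so g ∈ Gₘ by project invariance.
module Submission where

open import Defs
open import Axiom.ExcludedMiddle using (ExcludedMiddle)
open import Data.Empty using (⊥-elim)
open import Data.Fin.Base using (Fin; zero; suc; fromℕ<)
open import Data.List.Base using ([]; _∷_; _∷ʳ_; length; replicate)
open import Data.List.Properties using (length-++; length-replicate; ∷ʳ-injectiveˡ)
open import Data.Nat.Base using (ℕ; zero; suc; _+_; _≤_; _⊔_; _≤′_; ≤′-refl; ≤′-step; s≤s; z≤n)
open import Data.Nat.Properties using (+-comm; ≤-reflexive; ≤⇒≤′; <⇒≤; n≤1+n; m≤m⊔n; m≤n⊔m)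
open import Data.Product.Base using (∃-syntax; _×_; _,_; proj₁; proj₂)
open import Function.Base using (_∘_)
open import Level using (Level)
open import Relation.Binary.PropositionalEquality
  using (_≡_; refl; sym; trans; cong)
open import Relation.Nullary.Decidable.Core using (yes; no; decidable-stable)
open import Relation.Unary using (Pred; _∈_; _⊆_; _≐_)

AgreeOn : ∀ {d} → ℕ → TreeAut d → TreeAut d → Set
AgreeOn n g h = ∀ w → length w ≡ n → to g w ≡ to h w

agreeOn-pred : ∀ {d n} {g h : TreeAut d} → AgreeOn (suc n) g h → AgreeOn n g h
agreeOn-pred {g = g} {h} _ [] _ = trans (root g) (sym (root h))
-- `Fin d` may be empty, so the letter that lengthens `w` is taken from `w` itself.
agreeOn-pred {g = g} {h} agree w@(x ∷ _) ∣w∣≡n =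
  let (y , p) = child g w x
      (z , q) = child h w x
  in ∷ʳ-injectiveˡ (to g w) (to h w)
       (trans (sym p) (trans (agree (w ∷ʳ x) ∣w∷ʳx∣≡1+n) q))
  where
  ∣w∷ʳx∣≡1+n = trans (length-++ w) (trans (+-comm (length w) 1) (cong suc ∣w∣≡n))

agreeOn-mono : ∀ {d m n} {g h : TreeAut d} → m ≤ n → AgreeOn n g h → AgreeOn m g h
agreeOn-mono {g = g} {h} = go ∘ ≤⇒≤′
  where
  go : ∀ {m n} → m ≤′ n → AgreeOn n g h → AgreeOn m g h
  go ≤′-refl      agree = agree
  go (≤′-step m≤n) agree = go m≤n (agreeOn-pred {g = g} {h} agree)

-- The maximum of the finitely many thresholds works. This yields one level that serves all coset
-- representatives.
∃-uniform : ∀ {ℓ k} (P : Fin k → ℕ → Set ℓ) →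
  (∀ i {m n} → m ≤ n → P i m → P i n) → (∀ i → ∃[ n ] P i n) → ∃[ n ] (∀ i → P i n)
∃-uniform {k = zero}  P mono ex = 0 , λ ()
∃-uniform {k = suc k} P mono ex =
  let (m , p) = ex zero
      (n , q) = ∃-uniform (P ∘ suc) (mono ∘ suc) (ex ∘ suc)
  in m ⊔ n , λ { zero    → mono zero (m≤m⊔n m n) p
               ; (suc i) → mono (suc i) (m≤n⊔m m n) (q i) }

module _ {d : ℕ} {ℓ : Level} where

  closure-closed : (H : Pred (TreeAut d) ℓ) → closure (closure H) ⊆ closure H
  closure-closed H g∈ n =
    let (h , h∈ , h≈g) = g∈ n
        (k , k∈ , k≈h) = h∈ n
    in k , k∈ , λ w ∣w∣≡n → trans (k≈h w ∣w∣≡n) (h≈g w ∣w∣≡n)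

  -- A point outside a closed set is separated from it at some level, where the premise fails; for a
  -- point inside, any level does. If no level worked, every level would hold an approximation from
  -- `H`, so `g` would lie in `closure H`.
  closed-at-some-level : ExcludedMiddle ℓ → {H : Pred (TreeAut d) ℓ} → closure H ⊆ H →
    ∀ g → ∃[ n ] (∃[ h ] (h ∈ H × AgreeOn n h g) → g ∈ H)
  closed-at-some-level em {H} closed g
    with em {∃[ n ] (∃[ h ] (h ∈ H × AgreeOn n h g) → g ∈ H)}
  ... | yes found = found
  ... | no  none  = 0 , λ _ → closed λ n →
    decidable-stable em λ far → none (n , λ near → ⊥-elim (far near))

  -- Only finitely many cosets `r i ∙ H` occur, so one level decides for each `i` whether `r i ⁻¹`
  -- lies in `H`. The level is a successor because `maximalMixing` only speaks of `n ≥ 1`.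
  closed-finiteIndex⇒open : ExcludedMiddle ℓ → {G H : Pred (TreeAut d) ℓ} →
    IsSubgroup H → closure H ⊆ H → FiniteIndexIn G H → ∃[ n ] St G (suc n) ⊆ H
  closed-finiteIndex⇒open em {G} {H} H-subgroup closed (k , r , _ , cosets) = N , St⊆H
    where
    open IsSubgroup H-subgroup

    uniform : ∃[ n ] (∀ i → ∃[ h ] (h ∈ H × AgreeOn n h (r i ⁻¹)) → r i ⁻¹ ∈ H)
    uniform = ∃-uniform _
      (λ i m≤n test (h , h∈H , agree) →
        test (h , h∈H , agreeOn-mono {g = h} {h = r i ⁻¹} m≤n agree))
      (λ i → closed-at-some-level em {H} closed (r i ⁻¹))

    N = proj₁ uniform

    St⊆H : St G (suc N) ⊆ H
    St⊆H {g} (g∈G , fix) =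
      let (i , h , h∈H , g≋rh) = cosets g g∈G
          -- As `g` fixes the level and equals `r i ∙ h`, the factor `h` undoes `r i` there.
          h≈r⁻¹ : AgreeOn (suc N) h (r i ⁻¹)
          h≈r⁻¹ w ∣w∣≡n = trans (sym (from-to (r i) (to h w)))
            (cong (from (r i)) (trans (sym (g≋rh w)) (proj₂ (fix w ∣w∣≡n))))
          r⁻¹∈H = proj₂ uniform i
            (h , h∈H , agreeOn-mono {g = h} {h = r i ⁻¹} (n≤1+n N) h≈r⁻¹)
      -- `r i ⁻¹ ⁻¹` computes to the same map as `r i`, so `g≋rh` fits unchanged.
      in resp (sym ∘ g≋rh) (∙-closed (⁻¹-closed r⁻¹∈H) h∈H)

theorem5 : {ℓ : Level} → ExcludedMiddle ℓ →
    (𝕋 : Tower ℓ) → let open Tower 𝕋 in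
    (f : Fraction ∣ K ∣) → Rational.IsRationalFunction (raw K) f → 2 ≤ deg f →
    let open Arboreal 𝕋 f in
    TamelyRamified →
    (Exceptional → HasCharacteristic K 0 × CardinalityAtMostContinuum K) →
    (tree : MarkedTree) → Fractal (G∞ tree) → Martingale (G∞ tree) →
    (D : Presentation tree) (N : ℕ) → MixingSubgroup (G∞ tree) N (Gₘ D) →
    ProjectInvariant (Gₘ D) →
    Gₘ D ≐ maximalMixing (G∞ tree) N
theorem5 em 𝕋 f _ 2≤d _ _ tree _ _ D N mixingSubgroup projectInvariant = ⊆-max , max-⊆
  where
  open Arboreal 𝕋 f
  open MixingSubgroup mixingSubgroup

  -- Each case of `Gₘ` unfolds to a `closure`, that of `generic` through `normalClosure`.
  Gₘ-closed : ∀ D → closure (Gₘ {tree} D) ⊆ Gₘ D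
  Gₘ-closed (generic _ _) {g} = closure-closed _ {g}
  Gₘ-closed (torus _ _ _) {g} = closure-closed _ {g}

  ⊆-max : Gₘ D ⊆ maximalMixing (G∞ tree) N
  ⊆-max g∈ n v n≥1 ∣v∣≡n+N = mixing n v n≥1 (≤-reflexive (sym ∣v∣≡n+N)) g∈

  max-⊆ : maximalMixing (G∞ tree) N ⊆ Gₘ D
  max-⊆ g∈ =
    let (n , St⊆Gₘ) = closed-finiteIndex⇒open em isSubgroup (Gₘ-closed D) finiteIndex
        -- Any word of this length would do; `2≤d` provides a letter.
        v = replicate (suc n + N) (fromℕ< (<⇒≤ 2≤d))
        (h , ((h∈St , hv≡v) , section≋g)) = g∈ (suc n) v (s≤s z≤n) (length-replicate _)
    in projectInvariant v (h , (St⊆Gₘ h∈St , hv≡v) , section≋g)
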